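{- For every integer $n\ge 1$, the subalgebra of $R_n$ generated by the quasisymmetric invariants $\{F_{1^r} : r\ge 0\}$ is commutative.
   Context: Let $R_n=\mathbb{Q}[\theta_1,\dots,\theta_n]$ be the polynomial ring in anticommuting variables over $\mathbb{Q}$ (the exterior algebra on $n$ generators): $\theta_i\theta_j=-\theta_j\theta_i$ for $i\ne j$ and $\theta_i^2=0$. For $A=\{a_1<\cdots<a_r\}\subseteq [n]=\{1,\dots,n\}$ put $\theta_A=\theta_{a_1}\cdots\theta_{a_r}$. For $r\ge 0$ define $F_{1^r}=\sum_{A\subseteq[n],\,|A|=r}\theta_A$ (so $F_{1^0}=1$ and $F_{1^r}=0$ if $r>n$). These elements linearly span the quasisymmetric invariants of $R_n$. -}

module Defs where

open import Algebra.Bundles using (Ring)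
open import Data.Fin.Base using (Fin)
open import Data.Fin.Subset using (Subset; ∣_∣; inside; outside)
open import Data.Fin.Subset.Properties using (_∈?_)
open import Data.List.Base using (List; []; _∷_; _++_; map; filter; foldr; allFin)
open import Data.Nat.Base using (ℕ; zero; suc)
import Data.Nat.Properties as ℕ
open import Data.Product.Base using (∃; _,_)
import Data.Rational.Base as ℚ
open import Data.Rational.Base using (ℚ; 0ℚ; 1ℚ)
import Data.Vec.Base as Vec
open import Level using (Level; 0ℓ)
open import Relation.Binary.PropositionalEquality using (_≡_; _≢_)
open import Relation.Unary using (Pred)

infixl 6 _+_
infixl 7 _*_
infix  8 -_
infix  4 _≈_

-- R n is the associative unital ℚ-algebra presented by generators θ₁,…,θₙ
-- (indexed by Fin n) and the relations θᵢθⱼ = - θⱼθᵢ (i ≠ j), θᵢ² = 0: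
-- its elements are formal expressions, and _≈_ is the least congruence
-- containing the ℚ-algebra axioms and these relations.

data R (n : ℕ) : Set where
  scalar : ℚ → R n
  θ      : Fin n → R n
  _+_    : R n → R n → R n
  _*_    : R n → R n → R n
  -_     : R n → R n

0# : ∀ {n} → R n
0# = scalar 0ℚ

1# : ∀ {n} → R n
1# = scalar 1ℚ

data _≈_ {n : ℕ} : R n → R n → Set where
  ≈-refl  : ∀ {x} → x ≈ x
  ≈-sym   : ∀ {x y} → x ≈ y → y ≈ x
  ≈-trans : ∀ {x y z} → x ≈ y → y ≈ z → x ≈ z

  +-cong : ∀ {x x′ y y′} → x ≈ x′ → y ≈ y′ → x + y ≈ x′ + y′
  *-cong : ∀ {x x′ y y′} → x ≈ x′ → y ≈ y′ → x * y ≈ x′ * y′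
  -‿cong : ∀ {x x′} → x ≈ x′ → - x ≈ - x′

  +-assoc     : ∀ x y z → (x + y) + z ≈ x + (y + z)
  +-comm      : ∀ x y → x + y ≈ y + x
  +-identityˡ : ∀ x → 0# + x ≈ x
  -‿inverseˡ  : ∀ x → - x + x ≈ 0#
  *-assoc     : ∀ x y z → (x * y) * z ≈ x * (y * z)
  *-identityˡ : ∀ x → 1# * x ≈ x
  *-identityʳ : ∀ x → x * 1# ≈ x
  distribˡ    : ∀ x y z → x * (y + z) ≈ x * y + x * z
  distribʳ    : ∀ x y z → (y + z) * x ≈ y * x + z * x

  scalar-+       : ∀ p q → scalar (p ℚ.+ q) ≈ scalar p + scalar q
  scalar-*       : ∀ p q → scalar (p ℚ.* q) ≈ scalar p * scalar q
  scalar-central : ∀ p x → scalar p * x ≈ x * scalar p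

  θ-anticomm : ∀ {i j} → i ≢ j → θ i * θ j ≈ - (θ j * θ i)
  θ-square   : ∀ i → θ i * θ i ≈ 0#

R-ring : ℕ → Ring 0ℓ 0ℓ
R-ring n = record
  { Carrier = R n
  ; _≈_ = _≈_
  ; _+_ = _+_
  ; _*_ = _*_
  ; -_  = -_
  ; 0#  = 0#
  ; 1#  = 1#
  ; isRing = record
    { +-isAbelianGroup = record
      { isGroup = record
        { isMonoid = record
          { isSemigroup = record
            { isMagma = record
              { isEquivalence = record { refl = ≈-refl ; sym = ≈-sym ; trans = ≈-trans }
              ; ∙-cong = +-cong
              }
            ; assoc = +-assoc
            }
          ; identity = +-identityˡ , λ x → ≈-trans (+-comm x 0#) (+-identityˡ x)
          }
        ; inverse = -‿inverseˡ , λ x → ≈-trans (+-comm x (- x)) (-‿inverseˡ x)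
        ; ⁻¹-cong = -‿cong
        }
      ; comm = +-comm
      }
    ; *-cong = *-cong
    ; *-assoc = *-assoc
    ; *-identity = *-identityˡ , *-identityʳ
    ; distrib = distribˡ , distribʳ
    }
  }

-- The factors appear in increasing order of index, since allFin n is increasing.
θ⟨_⟩ : ∀ {n} → Subset n → R n
θ⟨_⟩ {n} A = foldr _*_ 1# (map θ (filter (_∈? A) (allFin n)))

-- Every subset of Fin n, each listed once.
subsets : ∀ n → List (Subset n)
subsets zero    = Vec.[] ∷ []
subsets (suc n) = map (outside Vec.∷_) (subsets n) ++ map (inside Vec.∷_) (subsets n)

-- F n r is F_{1^r} in R n.
F : ∀ n → ℕ → R n
F n r = foldr _+_ 0# (map θ⟨_⟩ (filter (λ A → ∣ A ∣ ℕ.≟ r) (subsets n)))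

-- The (unital) ℚ-subalgebra generated by S.  Closure under negation and
-- scalar multiplication follows from the scalar and *-closed constructors.
data Subalgebra {n : ℕ} {ℓ : Level} (S : Pred (R n) ℓ) : Pred (R n) ℓ where
  generator : ∀ {x} → S x → Subalgebra S x
  scalar    : ∀ q → Subalgebra S (scalar q)
  +-closed  : ∀ {x y} → Subalgebra S x → Subalgebra S y → Subalgebra S (x + y)
  *-closed  : ∀ {x y} → Subalgebra S x → Subalgebra S y → Subalgebra S (x * y)
  ≈-closed  : ∀ {x y} → x ≈ y → Subalgebra S x → Subalgebra S y

QSymGenerators : ∀ n → Pred (R n) 0ℓ
QSymGenerators n x = ∃ λ r → x ≡ F n r

{-# OPTIONS --safe #-}
module Submission where

-- Each F_{1^r} with r even is central and F_{1^{2k+1}} = F_1 F_{1^{2k}}.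
-- As F_1² = 0, the product of two F_{1^r} with r odd is therefore zero, so
-- the generators commute pairwise.

open import Defs
open import Algebra.Bundles using (Ring)
import Algebra.Properties.Ring as RingProperties
open import Data.Bool.Base using (true; false)
open import Data.Fin.Base using (Fin; zero; suc)
open import Data.Fin.Properties using () renaming (_≟_ to _≟ꟳ_)
open import Data.Fin.Subset using (Subset; ∣_∣; inside; outside)
open import Data.Fin.Subset.Properties using (_∈?_; drop-there)
open import Data.List.Base using (List; []; _∷_; _++_; map; filter; foldr; allFin; tabulate)
open import Data.List.Properties
  using (filter-++; filter-≐; filter-none; map-++; map-cong; map-∘; map-tabulate)
open import Data.List.Relation.Unary.All using (universal)
open import Data.Nat.Base as ℕ using (ℕ; zero; suc; _≤_)
import Data.Nat.Properties as ℕ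
open import Data.Product.Base using (_,_)
open import Data.Vec.Base as Vec using (there)
open import Function.Base using (_∘_; id)
open import Level using (Level)
open import Relation.Binary.PropositionalEquality as ≡ using (_≡_; refl; cong; module ≡-Reasoning)
import Relation.Binary.Reasoning.Setoid as SetoidReasoning
open import Relation.Nullary using (does; yes; no)
open import Relation.Unary using (Pred; Decidable)

-- Moving θ_i past a product of r generators costs the sign (-1)^r; if θ_i is among them, both
-- orders give 0. So F_{1^r} commutes with every θ_i when r is even, hence is central, and
-- anticommutes with every θ_i when r is odd. In F_1 F_{1^{2k}} the coefficient of θ_A with |A| =
-- 2k+1 is the alternating sum 1 - 1 + ... + 1 = 1, one sign for each element moved to its place, so
-- this product is F_{1^{2k+1}}. Since F_1 squares to 0 and the even factors are central, two odd
-- elements multiply to 0 in either order: they commute although odd elements also anticommute.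
-- Signs are not summed over subsets. Instead the first generator is split off (`∑-monomials≈E`),
-- and `E-even-central`, `E₁*E-even` and `E-odd*E-odd` follow by induction on the list of
-- generators. Commutation passes from the generators to the subalgebra because centralizers are
-- subalgebras.

private
  variable
    a p : Level
    A B : Set a

-- With the factor 2 on the right, `suc k ℕ.* 2` reduces to `suc (suc (k ℕ.* 2))`, so the recursion
-- of `E` unfolds at these indices by computation.
data EvenOrOdd : ℕ → Set where
  even : ∀ k → EvenOrOdd (k ℕ.* 2)
  odd  : ∀ k → EvenOrOdd (suc (k ℕ.* 2))

evenOrOdd : ∀ n → EvenOrOdd n
evenOrOdd zero = even 0
evenOrOdd (suc n) with evenOrOdd n
... | even k = odd k
... | odd  k = even (suc k)

filter-map : {P : Pred B p} (P? : Decidable P) (f : A → B) (xs : List A) →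
             filter P? (map f xs) ≡ map f (filter (P? ∘ f) xs)
filter-map P? f [] = refl
filter-map P? f (x ∷ xs) with does (P? (f x))
... | true  = cong (f x ∷_) (filter-map P? f xs)
... | false = filter-map P? f xs

-- Whether `suc i` lies in `s ∷ S` does not depend on `s`.
map-filter-∈-suc : ∀ {m} (f : Fin (suc m) → A) s (S : Subset m) →
  map f (filter (_∈? (s Vec.∷ S)) (tabulate suc)) ≡ map (f ∘ suc) (filter (_∈? S) (allFin m))
map-filter-∈-suc {m = m} f s S = begin
  map f (filter (_∈? (s Vec.∷ S)) (tabulate suc))
    ≡⟨ cong (map f ∘ filter (_∈? (s Vec.∷ S))) (map-tabulate id suc) ⟨
  map f (filter (_∈? (s Vec.∷ S)) (map suc (allFin m)))
    ≡⟨ cong (map f) (filter-map (_∈? (s Vec.∷ S)) suc (allFin m)) ⟩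
  map f (map suc (filter (λ i → suc i ∈? (s Vec.∷ S)) (allFin m)))
    ≡⟨ map-∘ (filter (λ i → suc i ∈? (s Vec.∷ S)) (allFin m)) ⟨
  map (f ∘ suc) (filter (λ i → suc i ∈? (s Vec.∷ S)) (allFin m))
    ≡⟨ cong (map (f ∘ suc))
         (filter-≐ (λ i → suc i ∈? (s Vec.∷ S)) (_∈? S) (drop-there , there) (allFin m)) ⟩
  map (f ∘ suc) (filter (_∈? S) (allFin m)) ∎
  where open ≡-Reasoning

-- The F_{1^r} of the exterior subalgebra on the listed generators.
E : ∀ {n} → List (Fin n) → ℕ → R n
E xs       zero    = 1#
E []       (suc r) = 0#
E (x ∷ xs) (suc r) = E xs (suc r) + θ x * E xs r

module _ {n : ℕ} where

  open Ring (R-ring n)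
    using (setoid; +-congˡ; +-congʳ; *-congˡ; *-congʳ; zeroˡ; zeroʳ; +-identityʳ; -‿inverseʳ)
  open RingProperties (R-ring n)
    using (-‿distribˡ-*; -‿distribʳ-*; -‿involutive; -‿+-comm; -0#≈0#)
  open SetoidReasoning setoid

  -- Recursion for F_{1^r} by splitting off the first generator

  ∑ : List (R n) → R n
  ∑ = foldr _+_ 0#

  ∑-++ : ∀ xs ys → ∑ (xs ++ ys) ≈ ∑ xs + ∑ ys
  ∑-++ []       ys = ≈-sym (+-identityˡ (∑ ys))
  ∑-++ (x ∷ xs) ys = ≈-trans (+-congˡ (∑-++ xs ys)) (≈-sym (+-assoc x (∑ xs) (∑ ys)))

  *-distribˡ-∑ : ∀ x ys → ∑ (map (x *_) ys) ≈ x * ∑ ys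
  *-distribˡ-∑ x []       = ≈-sym (zeroʳ x)
  *-distribˡ-∑ x (y ∷ ys) = ≈-trans (+-congˡ (*-distribˡ-∑ x ys)) (≈-sym (distribˡ x y (∑ ys)))

  -- This is `θ⟨_⟩` with its indices relabelled along `f`, so that induction on `m` can take place
  -- inside the fixed ring `R n`; `f = id` gives back `θ⟨_⟩`.
  monomial : ∀ {m} → (Fin m → Fin n) → Subset m → R n
  monomial f S = foldr _*_ 1# (map (θ ∘ f) (filter (_∈? S) (allFin _)))

  ∑-monomials : ∀ {m} → (Fin m → Fin n) → ℕ → R n
  ∑-monomials f r = ∑ (map (monomial f) (filter (λ S → ∣ S ∣ ℕ.≟ r) (subsets _)))

  monomial-outside : ∀ {m} (f : Fin (suc m) → Fin n) S →
    monomial f (outside Vec.∷ S) ≡ monomial (f ∘ suc) S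
  monomial-outside f S = cong (foldr _*_ 1#) (map-filter-∈-suc (θ ∘ f) outside S)

  -- Index `zero` is listed first, so its factor splits off on the left without a sign.
  monomial-inside : ∀ {m} (f : Fin (suc m) → Fin n) S →
    monomial f (inside Vec.∷ S) ≡ θ (f zero) * monomial (f ∘ suc) S
  monomial-inside f S = cong (λ xs → θ (f zero) * foldr _*_ 1# xs) (map-filter-∈-suc (θ ∘ f) inside S)

  module _ {m : ℕ} (f : Fin (suc m) → Fin n) where

    private
      ofSize : ∀ {k} → ℕ → List (Subset k) → List (Subset k)
      ofSize r = filter (λ S → ∣ S ∣ ℕ.≟ r)

    -- Subsets are sorted by whether they contain `zero`. The size condition on the second sum stays
    -- as `suc ∣ S ∣ ≡ r`, to be resolved separately for `r = 0`, where no subset qualifies, and for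
    -- `r` a successor.
    ∑-monomials-split : ∀ r → ∑-monomials f r ≈
      ∑-monomials (f ∘ suc) r +
      ∑ (map (monomial f ∘ (inside Vec.∷_)) (filter (λ S → suc ∣ S ∣ ℕ.≟ r) (subsets m)))
    ∑-monomials-split r = begin
      ∑ (map (monomial f) (ofSize r (outsides ++ insides)))
        ≡⟨ cong (∑ ∘ map (monomial f)) (filter-++ (λ S → ∣ S ∣ ℕ.≟ r) outsides insides) ⟩
      ∑ (map (monomial f) (ofSize r outsides ++ ofSize r insides))
        ≡⟨ cong ∑ (map-++ (monomial f) (ofSize r outsides) (ofSize r insides)) ⟩
      ∑ (map (monomial f) (ofSize r outsides) ++ map (monomial f) (ofSize r insides))
        ≈⟨ ∑-++ (map (monomial f) (ofSize r outsides)) _ ⟩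
      ∑ (map (monomial f) (ofSize r outsides)) + ∑ (map (monomial f) (ofSize r insides))
        ≡⟨ ≡.cong₂ (λ xs ys → ∑ xs + ∑ ys) onOutsides onInsides ⟩
      ∑-monomials (f ∘ suc) r +
      ∑ (map (monomial f ∘ (inside Vec.∷_)) (filter (λ S → suc ∣ S ∣ ℕ.≟ r) (subsets m))) ∎
      where
      outsides = map (outside Vec.∷_) (subsets m)
      insides  = map (inside Vec.∷_) (subsets m)

      onOutsides : map (monomial f) (ofSize r outsides) ≡
                   map (monomial (f ∘ suc)) (ofSize r (subsets m))
      onOutsides = ≡.trans
        (cong (map (monomial f)) (filter-map (λ S → ∣ S ∣ ℕ.≟ r) (outside Vec.∷_) (subsets m)))
        (≡.trans (≡.sym (map-∘ (ofSize r (subsets m))))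
                 (map-cong (monomial-outside f) (ofSize r (subsets m))))

      onInsides : map (monomial f) (ofSize r insides) ≡
                  map (monomial f ∘ (inside Vec.∷_)) (filter (λ S → suc ∣ S ∣ ℕ.≟ r) (subsets m))
      onInsides = ≡.trans
        (cong (map (monomial f)) (filter-map (λ S → ∣ S ∣ ℕ.≟ r) (inside Vec.∷_) (subsets m)))
        (≡.sym (map-∘ (filter (λ S → suc ∣ S ∣ ℕ.≟ r) (subsets m))))

    ∑-monomials-zero : ∑-monomials f 0 ≈ ∑-monomials (f ∘ suc) 0
    ∑-monomials-zero = begin
      ∑-monomials f 0
        ≈⟨ ∑-monomials-split 0 ⟩
      ∑-monomials (f ∘ suc) 0 +
      ∑ (map (monomial f ∘ (inside Vec.∷_)) (filter (λ S → suc ∣ S ∣ ℕ.≟ 0) (subsets m)))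
        ≡⟨ cong (λ Ss → ∑-monomials (f ∘ suc) 0 + ∑ (map (monomial f ∘ (inside Vec.∷_)) Ss))
             (filter-none (λ S → suc ∣ S ∣ ℕ.≟ 0) (universal (λ _ ()) (subsets m))) ⟩
      ∑-monomials (f ∘ suc) 0 + 0#
        ≈⟨ +-identityʳ _ ⟩
      ∑-monomials (f ∘ suc) 0 ∎

    ∑-monomials-suc : ∀ r → ∑-monomials f (suc r) ≈
      ∑-monomials (f ∘ suc) (suc r) + θ (f zero) * ∑-monomials (f ∘ suc) r
    ∑-monomials-suc r = begin
      ∑-monomials f (suc r)
        ≈⟨ ∑-monomials-split (suc r) ⟩
      rest + ∑ (map (monomial f ∘ (inside Vec.∷_)) (filter (λ S → suc ∣ S ∣ ℕ.≟ suc r) (subsets m)))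
        ≡⟨ cong (λ Ss → rest + ∑ (map (monomial f ∘ (inside Vec.∷_)) Ss))
             (filter-≐ (λ S → suc ∣ S ∣ ℕ.≟ suc r) (λ S → ∣ S ∣ ℕ.≟ r)
               (ℕ.suc-injective , cong suc) (subsets m)) ⟩
      rest + ∑ (map (monomial f ∘ (inside Vec.∷_)) (ofSize r (subsets m)))
        ≡⟨ cong (λ xs → rest + ∑ xs) (map-cong (monomial-inside f) (ofSize r (subsets m))) ⟩
      rest + ∑ (map ((θ (f zero) *_) ∘ monomial (f ∘ suc)) (ofSize r (subsets m)))
        ≡⟨ cong (λ xs → rest + ∑ xs) (map-∘ (ofSize r (subsets m))) ⟩
      rest + ∑ (map (θ (f zero) *_) (map (monomial (f ∘ suc)) (ofSize r (subsets m))))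
        ≈⟨ +-congˡ (*-distribˡ-∑ (θ (f zero)) (map (monomial (f ∘ suc)) (ofSize r (subsets m)))) ⟩
      rest + θ (f zero) * ∑-monomials (f ∘ suc) r ∎
      where rest = ∑-monomials (f ∘ suc) (suc r)

  ∑-monomials≈E : ∀ {m} (f : Fin m → Fin n) r → ∑-monomials f r ≈ E (tabulate f) r
  ∑-monomials≈E {zero}  f zero    = +-identityʳ 1#
  ∑-monomials≈E {zero}  f (suc r) = ≈-refl
  ∑-monomials≈E {suc m} f zero    =
    ≈-trans (∑-monomials-zero f) (∑-monomials≈E (f ∘ suc) zero)
  ∑-monomials≈E {suc m} f (suc r) =
    ≈-trans (∑-monomials-suc f r)
      (+-cong (∑-monomials≈E (f ∘ suc) (suc r)) (*-congˡ (∑-monomials≈E (f ∘ suc) r)))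

  F≈E : ∀ r → F n r ≈ E (allFin n) r
  F≈E = ∑-monomials≈E id

  -- Commutation, anticommutation and centrality

  Commutes Anticommutes : R n → R n → Set
  Commutes     x y = x * y ≈ y * x
  Anticommutes x y = x * y ≈ - (y * x)

  commutes-+ : ∀ {x y z} → Commutes x y → Commutes x z → Commutes x (y + z)
  commutes-+ {x} {y} {z} xy xz =
    ≈-trans (distribˡ x y z) (≈-trans (+-cong xy xz) (≈-sym (distribʳ x y z)))

  anticommutes-+ : ∀ {x y z} → Anticommutes x y → Anticommutes x z → Anticommutes x (y + z)
  anticommutes-+ {x} {y} {z} xy xz = begin
    x * (y + z)              ≈⟨ distribˡ x y z ⟩
    x * y + x * z            ≈⟨ +-cong xy xz ⟩
    - (y * x) + - (z * x)    ≈⟨ -‿+-comm (y * x) (z * x) ⟩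
    - (y * x + z * x)        ≈⟨ -‿cong (distribʳ x y z) ⟨
    - ((y + z) * x)          ∎

  commutes-* : ∀ {x y z} → Commutes x y → Commutes x z → Commutes x (y * z)
  commutes-* {x} {y} {z} xy xz = begin
    x * (y * z)    ≈⟨ *-assoc x y z ⟨
    x * y * z      ≈⟨ *-congʳ xy ⟩
    y * x * z      ≈⟨ *-assoc y x z ⟩
    y * (x * z)    ≈⟨ *-congˡ xz ⟩
    y * (z * x)    ≈⟨ *-assoc y z x ⟨
    y * z * x      ∎

  anticommutes-*-commutes : ∀ {x y z} →
    Anticommutes x y → Commutes x z → Anticommutes x (y * z)
  anticommutes-*-commutes {x} {y} {z} xy xz = begin
    x * (y * z)      ≈⟨ *-assoc x y z ⟨
    x * y * z        ≈⟨ *-congʳ xy ⟩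
    - (y * x) * z    ≈⟨ -‿distribˡ-* (y * x) z ⟨
    - (y * x * z)    ≈⟨ -‿cong (*-assoc y x z) ⟩
    - (y * (x * z))  ≈⟨ -‿cong (*-congˡ xz) ⟩
    - (y * (z * x))  ≈⟨ -‿cong (*-assoc y z x) ⟨
    - (y * z * x)    ∎

  anticommutes-* : ∀ {x y z} → Anticommutes x y → Anticommutes x z → Commutes x (y * z)
  anticommutes-* {x} {y} {z} xy xz = begin
    x * (y * z)      ≈⟨ *-assoc x y z ⟨
    x * y * z        ≈⟨ *-congʳ xy ⟩
    - (y * x) * z    ≈⟨ -‿distribˡ-* (y * x) z ⟨
    - (y * x * z)    ≈⟨ -‿cong (*-assoc y x z) ⟩
    - (y * (x * z))  ≈⟨ -‿distribʳ-* y (x * z) ⟩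
    y * - (x * z)    ≈⟨ *-congˡ (-‿cong xz) ⟩
    y * - - (z * x)  ≈⟨ *-congˡ (-‿involutive (z * x)) ⟩
    y * (z * x)      ≈⟨ *-assoc y z x ⟨
    y * z * x        ∎

  commutes-1# : ∀ x → Commutes x 1#
  commutes-1# x = ≈-trans (*-identityʳ x) (≈-sym (*-identityˡ x))

  commutes-0# : ∀ x → Commutes x 0#
  commutes-0# x = ≈-trans (zeroʳ x) (≈-sym (zeroˡ x))

  commutes-neg : ∀ {x y} → Commutes x y → Commutes x (- y)
  commutes-neg {x} {y} xy = begin
    x * - y    ≈⟨ -‿distribʳ-* x y ⟨
    - (x * y)  ≈⟨ -‿cong xy ⟩
    - (y * x)  ≈⟨ -‿distribˡ-* y x ⟩
    - y * x    ∎

  -- Elements of `R n` are formal expressions, so induction on the expression `y` suffices.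
  commutes-θ⇒central : ∀ {x} → (∀ i → Commutes x (θ i)) → ∀ y → Commutes x y
  commutes-θ⇒central {x} c (scalar q) = ≈-sym (scalar-central q x)
  commutes-θ⇒central c (θ i)   = c i
  commutes-θ⇒central c (y + z) = commutes-+ (commutes-θ⇒central c y) (commutes-θ⇒central c z)
  commutes-θ⇒central c (y * z) = commutes-* (commutes-θ⇒central c y) (commutes-θ⇒central c z)
  commutes-θ⇒central c (- y)   = commutes-neg (commutes-θ⇒central c y)

  -- The case `i = j` also holds, as both sides are 0; hence the inductions below need not ask
  -- whether `i` occurs in the list.
  θ-anticommutes : ∀ i j → Anticommutes (θ i) (θ j)
  θ-anticommutes i j with i ≟ꟳ j
  ... | no  i≢j  = θ-anticomm i≢j
  ... | yes refl = begin
    θ i * θ i      ≈⟨ θ-square i ⟩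
    0#             ≈⟨ -0#≈0# ⟨
    - 0#           ≈⟨ -‿cong (θ-square i) ⟨
    - (θ i * θ i)  ∎

  mutual
    -- The parities are proved together: in the term `θ x * E xs r` the second factor has the
    -- opposite parity, and `θ x` contributes one further sign.
    θ-commutes-E-even : ∀ i xs k → Commutes (θ i) (E xs (k ℕ.* 2))
    θ-commutes-E-even i xs       zero    = commutes-1# (θ i)
    θ-commutes-E-even i []       (suc k) = commutes-0# (θ i)
    θ-commutes-E-even i (x ∷ xs) (suc k) = commutes-+
      (θ-commutes-E-even i xs (suc k))
      (anticommutes-* (θ-anticommutes i x) (θ-anticommutes-E-odd i xs k))

    θ-anticommutes-E-odd : ∀ i xs k → Anticommutes (θ i) (E xs (suc (k ℕ.* 2)))
    θ-anticommutes-E-odd i []       k = begin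
      θ i * 0#      ≈⟨ zeroʳ (θ i) ⟩
      0#            ≈⟨ -0#≈0# ⟨
      - 0#          ≈⟨ -‿cong (zeroˡ (θ i)) ⟨
      - (0# * θ i)  ∎
    θ-anticommutes-E-odd i (x ∷ xs) k = anticommutes-+
      (θ-anticommutes-E-odd i xs k)
      (anticommutes-*-commutes (θ-anticommutes i x) (θ-commutes-E-even i xs k))

  E-even-central : ∀ xs k y → Commutes (E xs (k ℕ.* 2)) y
  E-even-central xs k = commutes-θ⇒central (λ i → ≈-sym (θ-commutes-E-even i xs k))

  -- Products with F_1

  E₁-square : ∀ xs → E xs 1 * E xs 1 ≈ 0#
  E₁-square []       = zeroˡ 0#
  E₁-square (x ∷ xs) = begin
    (e + θ x * 1#) * (e + θ x * 1#)              ≈⟨ *-cong e+θ1 e+θ1 ⟩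
    (e + θ x) * (e + θ x)                        ≈⟨ distribʳ (e + θ x) e (θ x) ⟩
    e * (e + θ x) + θ x * (e + θ x)              ≈⟨ +-cong (distribˡ e e (θ x)) (distribˡ (θ x) e (θ x)) ⟩
    -- The two squares vanish, and the mixed terms cancel because `θ x` anticommutes with `e`.
    (e * e + e * θ x) + (θ x * e + θ x * θ x)    ≈⟨ +-cong (+-congʳ (E₁-square xs)) (+-congˡ (θ-square x)) ⟩
    (0# + e * θ x) + (θ x * e + 0#)              ≈⟨ +-cong (+-identityˡ _) (+-identityʳ _) ⟩
    e * θ x + θ x * e                            ≈⟨ +-congˡ (θ-anticommutes-E-odd x xs 0) ⟩
    e * θ x + - (e * θ x)                        ≈⟨ -‿inverseʳ (e * θ x) ⟩
    0#                                           ∎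
    where
    e    = E xs 1
    e+θ1 = +-congˡ {e} (*-identityʳ (θ x))

  mutual
    -- Of the four terms of the expanded product, `e * u` and `θ x * u` form the recursion for the
    -- right-hand side. The other two vanish: one contains `θ x` twice, and the other is, up to
    -- sign, `θ x * (e * v)` with `v` odd, which is `E₁*E-odd` on the shorter list.
    E₁*E-even : ∀ xs k → E xs 1 * E xs (k ℕ.* 2) ≈ E xs (suc (k ℕ.* 2))
    E₁*E-even xs       zero    = *-identityʳ (E xs 1)
    E₁*E-even []       (suc k) = zeroˡ 0#
    E₁*E-even (x ∷ xs) (suc k) = begin
      (e + θ x * 1#) * (u + θ x * v)
        ≈⟨ *-congʳ (+-congˡ (*-identityʳ (θ x))) ⟩
      (e + θ x) * (u + θ x * v)
        ≈⟨ distribʳ (u + θ x * v) e (θ x) ⟩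
      e * (u + θ x * v) + θ x * (u + θ x * v)
        ≈⟨ +-cong (distribˡ e u (θ x * v)) (distribˡ (θ x) u (θ x * v)) ⟩
      (e * u + e * (θ x * v)) + (θ x * u + θ x * (θ x * v))
        ≈⟨ +-cong (+-cong (E₁*E-even xs (suc k)) eθv≈0) (+-congˡ θθv≈0) ⟩
      (E xs (suc (suc k ℕ.* 2)) + 0#) + (θ x * u + 0#)
        ≈⟨ +-cong (+-identityʳ _) (+-identityʳ _) ⟩
      E xs (suc (suc k ℕ.* 2)) + θ x * u ∎
      where
      e = E xs 1
      u = E xs (suc k ℕ.* 2)
      v = E xs (suc (k ℕ.* 2))

      θθv≈0 : θ x * (θ x * v) ≈ 0#
      θθv≈0 = begin
        θ x * (θ x * v)  ≈⟨ *-assoc (θ x) (θ x) v ⟨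
        θ x * θ x * v    ≈⟨ *-congʳ (θ-square x) ⟩
        0# * v           ≈⟨ zeroˡ v ⟩
        0#               ∎

      eθv≈0 : e * (θ x * v) ≈ 0#
      eθv≈0 = begin
        -- The double negation produces `- (e * θ x)`, the side of the anticommutation law that can
        -- be replaced by `θ x * e`.
        e * (θ x * v)        ≈⟨ -‿involutive _ ⟨
        - - (e * (θ x * v))  ≈⟨ -‿cong (-‿cong (*-assoc e (θ x) v)) ⟨
        - - (e * θ x * v)    ≈⟨ -‿cong (-‿distribˡ-* (e * θ x) v) ⟩
        - (- (e * θ x) * v)  ≈⟨ -‿cong (*-congʳ (θ-anticommutes-E-odd x xs 0)) ⟨
        - (θ x * e * v)      ≈⟨ -‿cong (*-assoc (θ x) e v) ⟩
        - (θ x * (e * v))    ≈⟨ -‿cong (*-congˡ (E₁*E-odd xs k)) ⟩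
        - (θ x * 0#)         ≈⟨ -‿cong (zeroʳ (θ x)) ⟩
        - 0#                 ≈⟨ -0#≈0# ⟩
        0#                   ∎

    E₁*E-odd : ∀ xs k → E xs 1 * E xs (suc (k ℕ.* 2)) ≈ 0#
    E₁*E-odd xs k = begin
      E xs 1 * E xs (suc (k ℕ.* 2))        ≈⟨ *-congˡ (E₁*E-even xs k) ⟨
      E xs 1 * (E xs 1 * E xs (k ℕ.* 2))   ≈⟨ *-assoc (E xs 1) (E xs 1) _ ⟨
      E xs 1 * E xs 1 * E xs (k ℕ.* 2)     ≈⟨ *-congʳ (E₁-square xs) ⟩
      0# * E xs (k ℕ.* 2)                  ≈⟨ zeroˡ _ ⟩
      0#                                   ∎

  -- Write the left factor as `E xs 1` times a central element; `E xs 1` then meets the right factor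
  -- and kills it.
  E-odd*E-odd : ∀ xs k l → E xs (suc (k ℕ.* 2)) * E xs (suc (l ℕ.* 2)) ≈ 0#
  E-odd*E-odd xs k l = begin
    E xs (suc (k ℕ.* 2)) * o              ≈⟨ *-congʳ (E₁*E-even xs k) ⟨
    E xs 1 * E xs (k ℕ.* 2) * o           ≈⟨ *-congʳ (E-even-central xs k (E xs 1)) ⟨
    E xs (k ℕ.* 2) * E xs 1 * o           ≈⟨ *-assoc _ (E xs 1) o ⟩
    E xs (k ℕ.* 2) * (E xs 1 * o)         ≈⟨ *-congˡ (E₁*E-odd xs l) ⟩
    E xs (k ℕ.* 2) * 0#                   ≈⟨ zeroʳ _ ⟩
    0#                                    ∎
    where o = E xs (suc (l ℕ.* 2))

  E-commute : ∀ xs r s → Commutes (E xs r) (E xs s)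
  E-commute xs r s with evenOrOdd r | evenOrOdd s
  ... | even k | _      = E-even-central xs k _
  ... | odd k  | even l = ≈-sym (E-even-central xs l _)
  ... | odd k  | odd l  = ≈-trans (E-odd*E-odd xs k l) (≈-sym (E-odd*E-odd xs l k))

  F-commute : ∀ r s → Commutes (F n r) (F n s)
  F-commute r s = begin
    F n r * F n s                          ≈⟨ *-cong (F≈E r) (F≈E s) ⟩
    E (allFin n) r * E (allFin n) s        ≈⟨ E-commute (allFin n) r s ⟩
    E (allFin n) s * E (allFin n) r        ≈⟨ *-cong (F≈E s) (F≈E r) ⟨
    F n s * F n r                          ∎

  -- From commuting generators to the subalgebra

  module _ {ℓ : Level} {S : Pred (R n) ℓ} where

    commutes-subalgebra : ∀ {x} → (∀ {y} → S y → Commutes x y) →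
                          ∀ {y} → Subalgebra S y → Commutes x y
    commutes-subalgebra c (generator y∈S)   = c y∈S
    commutes-subalgebra {x} c (scalar q)    = ≈-sym (scalar-central q x)
    commutes-subalgebra c (+-closed y∈ z∈)  =
      commutes-+ (commutes-subalgebra c y∈) (commutes-subalgebra c z∈)
    commutes-subalgebra c (*-closed y∈ z∈)  =
      commutes-* (commutes-subalgebra c y∈) (commutes-subalgebra c z∈)
    commutes-subalgebra c (≈-closed y≈z y∈) =
      ≈-trans (*-congˡ (≈-sym y≈z)) (≈-trans (commutes-subalgebra c y∈) (*-congʳ y≈z))

    -- The centralizer argument is used twice: each generator commutes with all of the subalgebra,
    -- so each `x` in the subalgebra commutes with the generators and hence with the whole
    -- subalgebra.
    subalgebra-commutative : (∀ {x y} → S x → S y → Commutes x y) →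
      ∀ {x y} → Subalgebra S x → Subalgebra S y → Commutes x y
    subalgebra-commutative c x∈ =
      commutes-subalgebra (λ y∈S → ≈-sym (commutes-subalgebra (c y∈S) x∈))

corollary2p4 : ∀ (n : ℕ) → 1 ≤ n → ∀ (x y : R n) →
    Subalgebra (QSymGenerators n) x → Subalgebra (QSymGenerators n) y → x * y ≈ y * x
corollary2p4 n _ x y =
  subalgebra-commutative λ { (r , refl) (s , refl) → F-commute r s }
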